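{- There exists a constant $\alpha>0$ such that for every $P_7$-free graph $G$, for every minimal separator $S$ of $G$, and for every probability measure $\mu$ on $S$, there exists a vertex $v\in V(G)$ satisfying $\mu(N(v))\ge \alpha$.
   Context: All graphs are finite, simple and undirected; $P_7$-free means having no induced path on $7$ vertices. $N(v)$ is the open neighbourhood of $v$, and for a measure $\mu$ on a set $S$ we write $\mu(N(v))$ for $\mu(N(v)\cap S)$. For distinct $s,t\in V(G)$, a set $S\subseteq V(G)$ is an $s$-$t$ separator if $s$ and $t$ lie in different connected components of $G\setminus S$; it is a minimal $s$-$t$ separator if no proper subset of it is an $s$-$t$ separator. $S$ is a minimal separator of $G$ if it is a minimal $s$-$t$ separator for some $s,t\in V(G)$.
   Formalization: The probability measure on S is taken to have rational values (and the constant α is rational); the case of real-valued measures is not stated, though it follows by density and continuity for each fixed graph and separator. -}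

module Defs where

open import Data.Nat using (ℕ; suc)
open import Data.Bool using (Bool; true; false; _∧_; if_then_else_)
open import Data.Fin using (Fin; toℕ; zero; suc)
open import Data.Fin.Subset using (Subset; _∈_; _∉_; _⊂_)
open import Data.Vec using (lookup)
open import Data.Rational using (ℚ; 0ℚ; 1ℚ; _+_; _≤_)
open import Data.Product using (Σ; _×_; ∃)
open import Data.Sum using (_⊎_)
open import Relation.Binary.PropositionalEquality using (_≡_)
open import Relation.Nullary using (¬_)
open import Function.Definitions using (Injective)

record Graph (n : ℕ) : Set where
  field
    adj   : Fin n → Fin n → Bool
    sym   : ∀ u v → adj u v ≡ adj v u
    irrefl : ∀ v → adj v v ≡ false
open Graph public

Adj : ∀ {n} → Graph n → Fin n → Fin n → Set
Adj G u v = adj G u v ≡ true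

InducedP7 : ∀ {n} → Graph n → Set
InducedP7 {n} G = Σ (Fin 7 → Fin n) λ f →
  Injective _≡_ _≡_ f ×
  (∀ i j → (Adj G (f i) (f j) → (suc (toℕ i) ≡ toℕ j ⊎ suc (toℕ j) ≡ toℕ i))
         × ((suc (toℕ i) ≡ toℕ j ⊎ suc (toℕ j) ≡ toℕ i) → Adj G (f i) (f j)))

P7Free : ∀ {n} → Graph n → Set
P7Free G = ¬ InducedP7 G

data WalkAvoiding {n} (G : Graph n) (S : Subset n) : Fin n → Fin n → Set where
  here : ∀ {v} → v ∉ S → WalkAvoiding G S v v
  step : ∀ {u v w} → u ∉ S → Adj G u v → WalkAvoiding G S v w → WalkAvoiding G S u w

Separator : ∀ {n} → Graph n → Subset n → Fin n → Fin n → Set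
Separator G S s t = ¬ (s ≡ t) × s ∉ S × t ∉ S × ¬ WalkAvoiding G S s t

MinimalSeparatorFor : ∀ {n} → Graph n → Subset n → Fin n → Fin n → Set
MinimalSeparatorFor {n} G S s t =
  Separator G S s t × (∀ (S' : Subset n) → S' ⊂ S → ¬ Separator G S' s t)

MinimalSeparator : ∀ {n} → Graph n → Subset n → Set
MinimalSeparator {n} G S = Σ (Fin n) λ s → Σ (Fin n) λ t → MinimalSeparatorFor G S s t

sumFin : ∀ {n} → (Fin n → ℚ) → ℚ
sumFin {ℕ.zero} f = 0ℚ
sumFin {suc n} f = f zero + sumFin (λ i → f (suc i))

measureOn : ∀ {n} → Subset n → (Fin n → ℚ) → (Fin n → Bool) → ℚ
measureOn S μ A = sumFin (λ u → if lookup S u ∧ A u then μ u else 0ℚ)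

-- A probability measure on S, given by nonnegative point masses on S summing to 1
-- (values of μ outside S are irrelevant).
IsProbabilityOn : ∀ {n} → Subset n → (Fin n → ℚ) → Set
IsProbabilityOn S μ = (∀ u → u ∈ S → 0ℚ ≤ μ u) × measureOn S μ (λ _ → true) ≡ 1ℚ

μN : ∀ {n} → Graph n → Subset n → (Fin n → ℚ) → Fin n → ℚ
μN G S μ v = measureOn S μ (adj G v)

{-# OPTIONS --safe #-}
module Submission where

-- Let A and B be the components of s and t in G \ S; both attach to all of S.
-- No x ∈ S starts induced P₄'s into both A and B, since together they would be a
-- P₇, so up to symmetry the x ∈ S starting no P₄ into A have measure at least ½.
-- Such an x has a neighbour a(x) ∈ A ∩ N(s) (unless x is adjacent to s), and
-- either starts a P₄ into B or has a neighbour b(x) ∈ B ∩ N(t).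
-- If every neighbourhood is light, averaging yields x, y, z each of which is
-- nonadjacent to the vertices chosen for the other two. Their a's form a clique
-- (else x a(x) s a(y) is a P₄ into A), and this forces one of the P₇'s
--   y a(y) a(x) x b₁ b₂ b₃,  z a(z) a(y) y b(y) b(x) x,  y b(y) t b(x) x a(x) a(z).
-- The goal is decidable, so the argument can be classical: decidability of
-- the P₄ property and attachments of S are obtained under a double negation.

open import Defs
open import Data.Bool using (Bool; true; false; _∧_; _∨_; not; if_then_else_)
open import Data.Bool.Properties using (¬-not)
import Data.Bool.Properties as Bool
open import Data.Empty using (⊥; ⊥-elim)
open import Data.Fin using (Fin; zero; suc; toℕ)
open import Data.Fin.Properties using (any?; all?; sequence) renaming (_≟_ to _≟ᶠ_)
open import Data.Fin.Subset using (Subset; _∈_; _∉_; _-_; ⁅_⁆)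
open import Data.Fin.Subset.Properties
  using (p─q⊆p; x∈p⇒p-x⊂p; x∈p∧x≢y⇒x∈p-y)
import Data.Integer as ℤ
open import Data.List using (List; []; _∷_; lookup)
open import Data.List.Relation.Unary.All using (All; []; _∷_)
open import Data.Nat using (ℕ)
import Data.Nat.Properties as ℕ
open import Data.Product using (Σ; ∃; _×_; _,_; proj₁; proj₂)
open import Data.Rational
  using (ℚ; 0ℚ; 1ℚ; ½; _<_; _≤_; _/_; _+_; _*_; positive; nonNegative)
open import Data.Rational.Properties hiding (_≟_)
open import Data.Sum using (_⊎_; inj₁; inj₂; [_,_]′)
open import Data.Unit using (⊤; tt)
import Data.Vec as Vec
open import Data.Vec.Relation.Unary.All as VecAll using ([]; _∷_)
open Vec using (Vec; []; _∷_)
open import Data.Vec.Properties using (lookup⇒[]=)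
open import Effect.Monad using (RawMonad)
open import Function using (_∘_)
open import Relation.Binary.PropositionalEquality
  using (_≡_; refl; trans; cong; cong₂; subst; module ≡-Reasoning)
import Relation.Binary.PropositionalEquality as ≡
open import Relation.Nullary using (¬_; Dec; yes; no; does; contradiction)
open import Relation.Nullary.Decidable
  using (toWitness; _→-dec_; _⊎-dec_; _×-dec_; ¬¬-excluded-middle)
open import Relation.Nullary.Negation using (¬¬-Monad)

open import Algebra.Bundles using (CommutativeRing)
open import Algebra.Properties.Semiring.Sum (CommutativeRing.semiring +-*-commutativeRing)
  using (sum; sum-cong-≗; ∑-distrib-+; ∑-comm; *-distribˡ-sum)
open import Algebra.Properties.Monoid.Mult +-0-monoid using () renaming (_×_ to _·_)

private variable n : ℕ

-- Booleans, double negation and finite sums.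

∧-true : ∀ {a b} → a ∧ b ≡ true → a ≡ true × b ≡ true
∧-true {true} {true} _ = refl , refl

∨-false : ∀ {a b} → a ∨ b ≡ false → a ≡ false × b ≡ false
∨-false {false} {false} _ = refl , refl

not-true : ∀ {a} → not a ≡ true → a ≡ false
not-true {false} _ = refl

-- Finiteness of `Fin n` is the reason: double negation is applicative, so it can be pulled out of a
-- finite product.
¬¬-∀ : {P : Fin n → Set} → (∀ i → ¬ ¬ P i) → ¬ ¬ (∀ i → P i)
¬¬-∀ = sequence (RawMonad.rawApplicative ¬¬-Monad)

sumFin≡sum : (f : Fin n → ℚ) → sumFin f ≡ sum f
sumFin≡sum {ℕ.zero}  f = refl
sumFin≡sum {ℕ.suc n} f = cong (f zero +_) (sumFin≡sum (f ∘ suc))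

sum-mono : {f g : Fin n → ℚ} → (∀ i → f i ≤ g i) → sum f ≤ sum g
sum-mono {ℕ.zero}  f≤g = ≤-refl
sum-mono {ℕ.suc n} f≤g = +-mono-≤ (f≤g zero) (sum-mono (f≤g ∘ suc))

<⇒≱ : ∀ {a b} → a < b → ¬ b ≤ a
<⇒≱ a<b b≤a = <-irrefl refl (<-≤-trans a<b b≤a)

*-mono-≤ˡ : ∀ {r a b} → 0ℚ ≤ r → a ≤ b → r * a ≤ r * b
*-mono-≤ˡ {r} r≥0 = *-monoˡ-≤-nonNeg r {{nonNegative r≥0}}

-- Bookkeeping for removals: when a set of measure `a` loses at most `b`, the remainder, of measure
-- `c`, still exceeds `d`.
≤+⇒< : ∀ {a b c d} → d + b < a → a ≤ c + b → d < c
≤+⇒< {a} {b} {c} {d} d+b<a a≤c+b = ≰⇒> λ c≤d →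
  <⇒≱ d+b<a (≤-trans a≤c+b (+-monoˡ-≤ b c≤d))

-- Measures of vertex sets and averaging over a digraph.

module Measure (S : Subset n) (μ : Fin n → ℚ) (μ≥0 : ∀ u → u ∈ S → 0ℚ ≤ μ u) where

  m : (Fin n → Bool) → ℚ
  m = measureOn S μ

  weight : (Fin n → Bool) → Fin n → ℚ
  weight A u = if Vec.lookup S u ∧ A u then μ u else 0ℚ

  m≡sum : ∀ A → m A ≡ sum (weight A)
  m≡sum A = sumFin≡sum (weight A)

  weight-cover : ∀ A B C →
    (∀ u → Vec.lookup S u ≡ true → A u ≡ true → B u ≡ true ⊎ C u ≡ true) →
    ∀ u → weight A u ≤ weight B u + weight C u
  weight-cover A B C cover u
    with Vec.lookup S u in u∈S | A u | B u | C u | cover u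
  ... | false | _     | _     | _     | _ = ≤-refl
  ... | true  | false | false | false | _ = ≤-refl
  ... | true  | false | false | true  | _ =
    ≤-trans (μ≥0 u (lookup⇒[]= u S u∈S)) (≤-reflexive (≡.sym (+-identityˡ _)))
  ... | true  | false | true  | false | _ =
    ≤-trans (μ≥0 u (lookup⇒[]= u S u∈S)) (≤-reflexive (≡.sym (+-identityʳ _)))
  ... | true  | false | true  | true  | _ =
    +-mono-≤ (μ≥0 u (lookup⇒[]= u S u∈S)) (μ≥0 u (lookup⇒[]= u S u∈S))
  ... | true  | true  | true  | false | _ = ≤-reflexive (≡.sym (+-identityʳ _))
  ... | true  | true  | false | true  | _ = ≤-reflexive (≡.sym (+-identityˡ _))
  ... | true  | true  | true  | true  | _ =
    ≤-trans (≤-reflexive (≡.sym (+-identityˡ _))) (+-monoˡ-≤ _ (μ≥0 u (lookup⇒[]= u S u∈S)))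
  ... | true  | true  | false | false | c with c refl refl
  ...   | inj₁ ()
  ...   | inj₂ ()

  m-cover : ∀ A B C →
    (∀ u → Vec.lookup S u ≡ true → A u ≡ true → B u ≡ true ⊎ C u ≡ true) →
    m A ≤ m B + m C
  m-cover A B C cover = begin
    m A                                  ≡⟨ m≡sum A ⟩
    sum (weight A)                       ≤⟨ sum-mono (weight-cover A B C cover) ⟩
    sum (λ u → weight B u + weight C u)  ≡⟨ ∑-distrib-+ (weight B) (weight C) ⟩
    sum (weight B) + sum (weight C)      ≡⟨ cong₂ _+_ (m≡sum B) (m≡sum C) ⟨
    m B + m C                            ∎
    where open ≤-Reasoning

  m-∅ : m (λ _ → false) ≡ 0ℚ
  m-∅ = trans (m≡sum _) (go n (Vec.lookup S) μ)
    where
    go : ∀ k (s : Fin k → Bool) (ν : Fin k → ℚ) →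
         sum (λ u → if s u ∧ false then ν u else 0ℚ) ≡ 0ℚ
    go ℕ.zero    s ν = refl
    go (ℕ.suc k) s ν rewrite Bool.∧-zeroʳ (s zero) | go k (s ∘ suc) (ν ∘ suc) = refl

  m-mono : ∀ A B → (∀ u → A u ≡ true → B u ≡ true) → m A ≤ m B
  m-mono A B A⊆B = begin
    m A                    ≤⟨ m-cover A B (λ _ → false) (λ u _ Au → inj₁ (A⊆B u Au)) ⟩
    m B + m (λ _ → false)  ≡⟨ cong (λ t → m B + t) m-∅ ⟩
    m B + 0ℚ               ≡⟨ +-identityʳ (m B) ⟩
    m B                    ∎
    where open ≤-Reasoning

  infixl 6 _∖_
  _∖_ : (Fin n → Bool) → (Fin n → Bool) → Fin n → Bool
  (A ∖ B) u = A u ∧ not (B u)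

  m-∖ : ∀ A B → m A ≤ m (A ∖ B) + m B
  m-∖ A B = m-cover A (A ∖ B) B split
    where
    split : ∀ u → Vec.lookup S u ≡ true → A u ≡ true → (A ∖ B) u ≡ true ⊎ B u ≡ true
    split u _ Au with A u | B u
    split u _ refl | true | true  = inj₂ refl
    split u _ refl | true | false = inj₁ refl

  weight-∧ : ∀ (A B : Fin n → Bool) u → weight (λ v → A v ∧ B v) u ≡ (if B u then weight A u else 0ℚ)
  weight-∧ A B u with Vec.lookup S u | A u | B u
  ... | false | _     | false = refl
  ... | false | _     | true  = refl
  ... | true  | false | false = refl
  ... | true  | false | true  = refl
  ... | true  | true  | false = refl
  ... | true  | true  | true  = refl

  weight≥0 : ∀ A u → 0ℚ ≤ weight A u
  weight≥0 A u with Vec.lookup S u in u∈S | A u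
  ... | false | _     = ≤-refl
  ... | true  | false = ≤-refl
  ... | true  | true  = μ≥0 u (lookup⇒[]= u S u∈S)

  module _ (R : Fin n → Fin n → Bool) (T : Fin n → Bool) where

    out in′ : Fin n → Fin n → Bool
    out u v = T v ∧ R u v
    in′ v u = T u ∧ R u v

    -- With `R` read as a digraph, both sides sum `weight T u * weight T v` over the arcs from `u`
    -- to `v`, grouped by tail on the left and by head on the right.
    double-count : sum (λ u → weight T u * m (out u)) ≡ sum (λ v → weight T v * m (in′ v))
    double-count = begin
      sum (λ u → weight T u * m (out u))
        ≡⟨ sum-cong-≗ (λ u → expand u (out u)) ⟩
      sum (λ u → sum (λ v → weight T u * weight (out u) v))
        ≡⟨ ∑-comm (λ u v → weight T u * weight (out u) v) ⟩
      sum (λ v → sum (λ u → weight T u * weight (out u) v))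
        ≡⟨ sum-cong-≗ (λ v → sum-cong-≗ (λ u → swap u v)) ⟩
      sum (λ v → sum (λ u → weight T v * weight (in′ v) u))
        ≡⟨ sum-cong-≗ (λ v → expand v (in′ v)) ⟨
      sum (λ v → weight T v * m (in′ v))  ∎
      where
      open ≡-Reasoning
      expand : ∀ u A → weight T u * m A ≡ sum (λ v → weight T u * weight A v)
      expand u A = trans (cong (weight T u *_) (m≡sum A)) (*-distribˡ-sum (weight T u) (weight A))
      swap : ∀ u v → weight T u * weight (out u) v ≡ weight T v * weight (in′ v) u
      swap u v rewrite weight-∧ T (R u) v | weight-∧ T (λ t → R t v) u with R u v
      ... | true  = *-comm (weight T u) (weight T v)
      ... | false = trans (*-zeroʳ (weight T u)) (≡.sym (*-zeroʳ (weight T v)))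

    -- The `T`-weighted mean of the in-measures equals that of the out-measures, which is at most
    -- `β`, so the in-measures cannot all exceed `c`. The gap between `β` and `c` lets non-strict
    -- comparisons of sums suffice.
    low-in-degree : ∀ {β c} → β < c → (∀ u → m (R u) ≤ β) → 0ℚ < m T →
                    ∃ λ x → T x ≡ true × m (in′ x) ≤ c
    low-in-degree {β} {c} β<c out≤β T>0
      with any? (λ x → (T x Bool.≟ true) ×-dec (m (in′ x) ≤? c))
    ... | yes found = found
    ... | no  none  = contradiction (*-cancelˡ-≤-pos (m T) {{positive T>0}} mT*c≤mT*β) (<⇒≱ β<c)
      where
      open ≤-Reasoning
      scale : ∀ d → m T * d ≡ sum (λ u → weight T u * d)
      scale d = begin-equality
        m T * d                       ≡⟨ *-comm (m T) d ⟩
        d * m T                       ≡⟨ cong (d *_) (m≡sum T) ⟩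
        d * sum (weight T)            ≡⟨ *-distribˡ-sum d (weight T) ⟩
        sum (λ u → d * weight T u)    ≡⟨ sum-cong-≗ (λ u → *-comm d (weight T u)) ⟩
        sum (λ u → weight T u * d)    ∎
      high : ∀ x → weight T x * c ≤ weight T x * m (in′ x)
      high x with T x Bool.≟ true
      ... | yes Tx = *-mono-≤ˡ (weight≥0 T x) (<⇒≤ (≰⇒> λ le → none (x , Tx , le)))
      -- Off `T` the weight vanishes, so both sides are zero.
      ... | no ¬Tx rewrite ¬-not ¬Tx | Bool.∧-zeroʳ (Vec.lookup S x) =
        ≤-reflexive (trans (*-zeroˡ c) (≡.sym (*-zeroˡ (m (in′ x)))))
      low : ∀ u → weight T u * m (out u) ≤ weight T u * β
      low u = *-mono-≤ˡ (weight≥0 T u)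
        (≤-trans (m-mono (out u) (R u) (λ v → proj₂ ∘ ∧-true)) (out≤β u))
      mT*c≤mT*β : m T * c ≤ m T * β
      mT*c≤mT*β = begin
        m T * c                             ≡⟨ scale c ⟩
        sum (λ x → weight T x * c)          ≤⟨ sum-mono high ⟩
        sum (λ x → weight T x * m (in′ x))  ≡⟨ double-count ⟨
        sum (λ u → weight T u * m (out u))  ≤⟨ sum-mono low ⟩
        sum (λ u → weight T u * β)          ≡⟨ scale β ⟨
        m T * β                             ∎

  module _ (R : Fin n → Fin n → Bool) {β c : ℚ} (β<c : β < c) (out≤β : ∀ u → m (R u) ≤ β) where

    Unrelated : Fin n → Fin n → Set
    Unrelated x y = R x y ≡ false × R y x ≡ false

    -- Take `x` of low in-measure, then discard its out-neighbours, at most `β`, and its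
    -- in-neighbours inside `T`, at most `c`.
    split-off : ∀ T → 0ℚ < m T → ∃ λ x → T x ≡ true × Σ (Fin n → Bool) λ T′ →
                (∀ y → T′ y ≡ true → T y ≡ true × Unrelated x y) × m T ≤ m T′ + (β + c)
    split-off T T>0 with low-in-degree R T β<c out≤β T>0
    ... | x , Tx , in≤c = x , Tx , T ∖ D , member , bound
      where
      I D : Fin n → Bool
      I u = T u ∧ R u x
      D u = R x u ∨ I u
      D≤ : m D ≤ β + c
      D≤ = ≤-trans (m-cover D (R x) I (λ u _ → either u)) (+-mono-≤ (out≤β x) in≤c)
        where
        either : ∀ u → D u ≡ true → R x u ≡ true ⊎ I u ≡ true
        either u Du with R x u
        ... | true  = inj₁ refl
        ... | false = inj₂ Du
      member : ∀ y → (T ∖ D) y ≡ true → T y ≡ true × Unrelated x y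
      member y h with ∧-true {T y} h
      ... | Ty , ¬Dy with ∨-false {R x y} (not-true ¬Dy)
      ... | xy , Iy rewrite Ty = refl , xy , Iy
      bound : m T ≤ m (T ∖ D) + (β + c)
      bound = ≤-trans (m-∖ T D) (+-monoʳ-≤ (m (T ∖ D)) D≤)

    -- Two removals precede the third choice, each costing at most `β + c`, and that choice needs
    -- only positive measure. Distinctness is not asserted: in the application every point of `T` is
    -- `R`-related to itself, which excludes repetitions.
    independent-triple : ∀ T → 0ℚ ≤ β + c → (β + c) + (β + c) < m T →
      ∃ λ x → ∃ λ y → ∃ λ z → T x ≡ true × T y ≡ true × T z ≡ true ×
        Unrelated x y × Unrelated x z × Unrelated y z
    independent-triple T δ≥0 big with split-off T (≤-<-trans (+-mono-≤ δ≥0 δ≥0) big)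
    ... | x , Tx , T₁ , in₁ , T≤ with ≤+⇒< big T≤
    ... | big₁ with split-off T₁ (≤-<-trans δ≥0 big₁)
    ... | y , T₁y , T₂ , in₂ , T₁≤
      with split-off T₂ (≤+⇒< (subst (_< m T₁) (≡.sym (+-identityˡ (β + c))) big₁) T₁≤)
    ... | z , T₂z , _ with in₁ y T₁y | in₂ z T₂z
    ... | Ty , xy | T₁z , yz with in₁ z T₁z
    ... | Tz , xz = x , y , z , Tx , Ty , Tz , xy , xz , yz

-- Induced paths, components and attachments.

module Paths (G : Graph n) where

  infix 4 _~_ _≁_
  _~_ _≁_ : Fin n → Fin n → Set
  u ~ v = adj G u v ≡ true
  u ≁ v = adj G u v ≡ false

  ~-sym : ∀ {u v} → u ~ v → v ~ u
  ~-sym {u} {v} = trans (Graph.sym G v u)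

  ≁-sym : ∀ {u v} → u ≁ v → v ≁ u
  ≁-sym {u} {v} = trans (Graph.sym G v u)

  ~⇒¬≁ : ∀ {u v} → u ~ v → ¬ u ≁ v
  ~⇒¬≁ u~v u≁v with trans (≡.sym u~v) u≁v
  ... | ()

  -- Distinctness of the vertices is left out; for seven vertices `inducedP₇` recovers it from the
  -- adjacencies.
  IsPath : List (Fin n) → Set
  IsPath []           = ⊤
  IsPath (u ∷ [])     = ⊤
  IsPath (u ∷ v ∷ vs) = u ~ v × All (u ≁_) vs × IsPath (v ∷ vs)

  Consecutive : ∀ {k l} → Fin k → Fin l → Set
  Consecutive i j = ℕ.suc (toℕ i) ≡ toℕ j ⊎ ℕ.suc (toℕ j) ≡ toℕ i

  consecutive? : ∀ {k l} (i : Fin k) (j : Fin l) → Dec (Consecutive i j)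
  consecutive? i j = (ℕ.suc (toℕ i) ℕ.≟ toℕ j) ⊎-dec (ℕ.suc (toℕ j) ℕ.≟ toℕ i)

  ≁-lookup : ∀ {u vs} → All (u ≁_) vs → ∀ j → u ≁ lookup vs j
  ≁-lookup (p ∷ _)  zero    = p
  ≁-lookup (_ ∷ ps) (suc j) = ≁-lookup ps j

  path-edge : ∀ vs → IsPath vs → ∀ i j → ℕ.suc (toℕ i) ≡ toℕ j → lookup vs i ~ lookup vs j
  path-edge (u ∷ v ∷ vs) (u~v , _ , _) zero    (suc zero) _  = u~v
  path-edge (u ∷ v ∷ vs) (_ , _ , p)   (suc i) (suc j)    eq = path-edge (v ∷ vs) p i j (ℕ.suc-injective eq)

  path-adjacent⇒consecutive : ∀ vs → IsPath vs → ∀ i j → lookup vs i ~ lookup vs j → Consecutive i j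
  path-adjacent⇒consecutive (u ∷ vs)     p zero zero e = contradiction (irrefl G u) (~⇒¬≁ e)
  path-adjacent⇒consecutive (u ∷ v ∷ vs) p zero (suc zero) e = inj₁ refl
  path-adjacent⇒consecutive (u ∷ v ∷ vs) p (suc zero) zero e = inj₂ refl
  path-adjacent⇒consecutive (u ∷ v ∷ vs) (_ , far , _) zero (suc (suc j)) e =
    contradiction (≁-lookup far j) (~⇒¬≁ e)
  path-adjacent⇒consecutive (u ∷ v ∷ vs) (_ , far , _) (suc (suc i)) zero e =
    contradiction (≁-sym (≁-lookup far i)) (~⇒¬≁ e)
  path-adjacent⇒consecutive (u ∷ v ∷ vs) (_ , _ , p) (suc i) (suc j) e
    with path-adjacent⇒consecutive (v ∷ vs) p i j e
  ... | inj₁ eq = inj₁ (cong ℕ.suc eq)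
  ... | inj₂ eq = inj₂ (cong ℕ.suc eq)

  -- A finite check. A map that preserves and reflects adjacency can identify only vertices with
  -- equal neighbourhoods, so on the path it is injective.
  P₇-twin-free : ∀ (i j : Fin 7) → (∀ (k : Fin 7) → Consecutive i k → Consecutive j k) →
                 (∀ (k : Fin 7) → Consecutive j k → Consecutive i k) → i ≡ j
  P₇-twin-free = toWitness {a? = all? λ i → all? λ j →
    all? (λ k → consecutive? i k →-dec consecutive? j k) →-dec
    (all? (λ k → consecutive? j k →-dec consecutive? i k) →-dec (i ≟ᶠ j))} tt

  inducedP₇ : ∀ v₀ v₁ v₂ v₃ v₄ v₅ v₆ →
    IsPath (v₀ ∷ v₁ ∷ v₂ ∷ v₃ ∷ v₄ ∷ v₅ ∷ v₆ ∷ []) → InducedP7 G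
  inducedP₇ v₀ v₁ v₂ v₃ v₄ v₅ v₆ path = f , injective , λ i j → near i j , edge i j
    where
    vs : List (Fin n)
    vs = v₀ ∷ v₁ ∷ v₂ ∷ v₃ ∷ v₄ ∷ v₅ ∷ v₆ ∷ []
    f : Fin 7 → Fin n
    f = lookup vs
    near : ∀ i j → f i ~ f j → Consecutive i j
    near = path-adjacent⇒consecutive vs path
    edge : ∀ i j → Consecutive i j → f i ~ f j
    edge i j (inj₁ eq) = path-edge vs path i j eq
    edge i j (inj₂ eq) = ~-sym (path-edge vs path j i eq)
    transfer : ∀ {i j} → f i ≡ f j → ∀ k → Consecutive i k → Consecutive j k
    transfer {i} {j} eq k c = near j k (subst (_~ f k) eq (edge i k c))
    injective : ∀ {i j} → f i ≡ f j → i ≡ j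
    injective {i} {j} eq = P₇-twin-free i j (transfer eq) (transfer (≡.sym eq))

  nbhd : ∀ {k} → Vec (Fin n) k → Fin n → Bool
  nbhd []       v = false
  nbhd (u ∷ us) v = adj G u v ∨ nbhd us v

  ∉nbhd : ∀ {k v} (us : Vec (Fin n) k) → nbhd us v ≡ false → VecAll.All (_≁ v) us
  ∉nbhd []       _ = []
  ∉nbhd {v = v} (u ∷ us) h with ∨-false {adj G u v} h
  ... | u≁v , us≁v = u≁v ∷ ∉nbhd us us≁v

  record P₄Into (C : Fin n → Set) (x c₁ c₂ c₃ : Fin n) : Set where
    constructor p₄
    field
      c₁∈ : C c₁
      c₂∈ : C c₂
      c₃∈ : C c₃
      path : IsPath (x ∷ c₁ ∷ c₂ ∷ c₃ ∷ [])

  StartsP₄ : (Fin n → Set) → Fin n → Set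
  StartsP₄ C x = ∃ λ c₁ → ∃ λ c₂ → ∃ λ c₃ → P₄Into C x c₁ c₂ c₃

  Link : (C : Fin n → Set) (p x : Fin n) → Set
  Link C p x = ∃ λ c → C c × x ~ c × c ~ p

  Anticomplete : (A B : Fin n → Set) → Set
  Anticomplete A B = ∀ {a b} → A a → B b → a ≁ b

  start∉ : ∀ {S u v} → WalkAvoiding G S u v → u ∉ S
  start∉ (here u∉)     = u∉
  start∉ (step u∉ _ _) = u∉

  module _ (S : Subset n) where

    reverse-onto : ∀ {u v w} → WalkAvoiding G S u v → WalkAvoiding G S u w → WalkAvoiding G S v w
    reverse-onto (here _)       acc = acc
    reverse-onto (step _ u~ p)  acc = reverse-onto p (step (start∉ p) (~-sym u~) acc)

    reverse : ∀ {u v} → WalkAvoiding G S u v → WalkAvoiding G S v u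
    reverse p = reverse-onto p (here (start∉ p))

    component : Fin n → Fin n → Set
    component p u = WalkAvoiding G S u p

    component-anticomplete : ∀ {p r} → ¬ WalkAvoiding G S p r →
                             Anticomplete (component p) (component r)
    component-anticomplete sep a→p b→r = ¬-not λ a~b →
      sep (reverse-onto a→p (step (start∉ a→p) a~b b→r))

    -- Follow the walk to `p`, keeping `x` adjacent to the current vertex or joined to it by a
    -- middle vertex `c` of the component. This breaks at a step from `u` to `v` only if `x` misses
    -- both and `c` misses `v`, and then `x c u v` is an induced P₄.
    walk-link : ∀ {p u} x → WalkAvoiding G S u p → x ~ u ⊎ Link (component p) u x →
                x ~ p ⊎ Link (component p) p x ⊎ StartsP₄ (component p) x
    walk-link x (here _) (inj₁ x~p)  = inj₁ x~p
    walk-link x (here _) (inj₂ link) = inj₂ (inj₁ link)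
    walk-link x walk@(step {u} {v} _ u~v rest) near with adj G x v in x?v
    ... | true = walk-link x rest (inj₁ x?v)
    ... | false with adj G x u in x?u | near
    ...   | true  | _       = walk-link x rest (inj₂ (u , walk , x?u , u~v))
    ...   | false | inj₁ ()
    ...   | false | inj₂ (c , c∈ , x~c , c~u) with adj G c v in c?v
    ...     | true  = walk-link x rest (inj₂ (c , c∈ , x~c , c?v))
    ...     | false = inj₂ (inj₂ (c , u , v , p₄ c∈ walk rest
                (x~c , (x?u ∷ x?v ∷ []) , c~u , (c?v ∷ []) , u~v , [] , tt)))

    link-or-P₄ : ∀ {p} x → x ≁ p → (∃ λ a → component p a × x ~ a) →
                 Link (component p) p x ⊎ StartsP₄ (component p) x
    link-or-P₄ x x≁p (a , a∈ , x~a) with walk-link x a∈ (inj₁ x~a)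
    ... | inj₁ x~p = contradiction x≁p (~⇒¬≁ x~p)
    ... | inj₂ r   = r

    -- `back` collects the part already walked, which avoids all of `S`. If the next vertex is `x`,
    -- the current one is the attachment sought; if `x` never occurs, the whole walk avoids `S`.
    first-hit : ∀ {u s t x} → WalkAvoiding G (S - x) u t → WalkAvoiding G S u s →
                (∃ λ a → component s a × x ~ a) ⊎ WalkAvoiding G S t s
    first-hit (here _) back = inj₂ back
    first-hit {x = x} (step {u} {v} _ u~v rest) back with v ≟ᶠ x
    ... | yes refl = inj₁ (u , back , ~-sym u~v)
    ... | no  v≢x  = first-hit rest (step v∉S (~-sym u~v) back)
      where
      v∉S : v ∉ S
      v∉S v∈S = start∉ rest (x∈p∧x≢y⇒x∈p-y v∈S v≢x)

    -- Without an attachment `S - x` would still separate, against minimality. Minimality only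
    -- refutes separation and yields no walk, hence the double negation.
    attached : ∀ {s t} → MinimalSeparatorFor G S s t →
               ∀ x → x ∈ S → ¬ ¬ (∃ λ a → component s a × x ~ a)
    attached {s} {t} ((s≢t , s∉S , t∉S , sep) , minimal) x x∈S none =
      minimal (S - x) (x∈p⇒p-x⊂p x∈S)
        (s≢t , s∉S ∘ p─q⊆p S ⁅ x ⁆ , t∉S ∘ p─q⊆p S ⁅ x ⁆ , λ walk →
          [ none , sep ∘ reverse ]′ (first-hit walk (here s∉S)))

  Separator-sym : ∀ {S s t} → Separator G S s t → Separator G S t s
  Separator-sym {S} (s≢t , s∉S , t∉S , sep) = s≢t ∘ ≡.sym , t∉S , s∉S , sep ∘ reverse S

  MinimalSeparatorFor-sym : ∀ {S s t} → MinimalSeparatorFor G S s t → MinimalSeparatorFor G S t s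
  MinimalSeparatorFor-sym (sep , minimal) =
    Separator-sym sep , λ S′ S′⊂S sep′ → minimal S′ S′⊂S (Separator-sym sep′)

  -- The forbidden paths on seven vertices.

  module _ (free : P7Free G) (A B : Fin n → Set) (A≁B : Anticomplete A B) where

    P₄-one-side : ∀ {x} → StartsP₄ A x → ¬ StartsP₄ B x
    P₄-one-side {x}
      (a₁ , a₂ , a₃ , p₄ A₁ A₂ A₃ (xa₁ , (xa₂ ∷ xa₃ ∷ []) , a₁a₂ , (a₁a₃ ∷ []) , a₂a₃ , _))
      (b₁ , b₂ , b₃ , p₄ B₁ B₂ B₃ (xb₁ , (xb₂ ∷ xb₃ ∷ []) , b₁b₂ , (b₁b₃ ∷ []) , b₂b₃ , _)) =
      free (inducedP₇ a₃ a₂ a₁ x b₁ b₂ b₃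
        ( ~-sym a₂a₃ , (≁-sym a₁a₃ ∷ ≁-sym xa₃ ∷ A≁B A₃ B₁ ∷ A≁B A₃ B₂ ∷ A≁B A₃ B₃ ∷ [])
        , ~-sym a₁a₂ , (≁-sym xa₂ ∷ A≁B A₂ B₁ ∷ A≁B A₂ B₂ ∷ A≁B A₂ B₃ ∷ [])
        , ~-sym xa₁ , (A≁B A₁ B₁ ∷ A≁B A₁ B₂ ∷ A≁B A₁ B₃ ∷ [])
        , xb₁ , (xb₂ ∷ xb₃ ∷ []) , b₁b₂ , (b₁b₃ ∷ []) , b₂b₃ , [] , tt ))

    module Frames {p r : Fin n} (Ap : A p) (Br : B r) where

      -- b₂ and b₃ are meaningful only when x starts a P₄ into B; otherwise they are fillers.
      data Frame (x : Fin n) : Vec (Fin n) 5 → Set where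
        frame : ∀ {a b₁ b₂ b₃} → x ≁ p → x ≁ r → ¬ StartsP₄ A x →
                A a → x ~ a → a ~ p → B b₁ → x ~ b₁ →
                b₁ ~ r ⊎ P₄Into B x b₁ b₂ b₃ → Frame x (x ∷ a ∷ b₁ ∷ b₂ ∷ b₃ ∷ [])

      make-frame : ∀ {x} → x ≁ p → x ≁ r → ¬ StartsP₄ A x →
                   Link A p x → Link B r x ⊎ StartsP₄ B x → ∃ (Frame x)
      make-frame {x} x≁p x≁r ¬P₄A (a , Aa , x~a , a~p) (inj₁ (b , Bb , x~b , b~r)) =
        x ∷ a ∷ b ∷ b ∷ b ∷ [] , frame x≁p x≁r ¬P₄A Aa x~a a~p Bb x~b (inj₁ b~r)
      make-frame x≁p x≁r ¬P₄A (a , Aa , x~a , a~p)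
                 (inj₂ (b₁ , b₂ , b₃ , path@(p₄ Bb₁ _ _ (x~b₁ , _)))) =
        _ , frame x≁p x≁r ¬P₄A Aa x~a a~p Bb₁ x~b₁ (inj₂ path)

      links-adjacent : ∀ {x a a′} → ¬ StartsP₄ A x → x ≁ p → A a → x ~ a → a ~ p →
                       A a′ → a′ ~ p → x ≁ a′ → a ~ a′
      links-adjacent {x} {a} {a′} ¬P₄A x≁p Aa x~a a~p Aa′ a′~p x≁a′ with adj G a a′ in a?a′
      ... | true  = refl
      ... | false = ⊥-elim (¬P₄A (a , p , a′ , p₄ Aa Ap Aa′
              (x~a , (x≁p ∷ x≁a′ ∷ []) , a~p , (a?a′ ∷ []) , ~-sym a′~p , [] , tt)))

      Separated : ∀ {k} → Fin n → Vec (Fin n) k → Fin n → Vec (Fin n) k → Set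
      Separated x us y vs = VecAll.All (_≁ y) us × VecAll.All (_≁ x) vs

      -- The index picks `b₁`. Were `x b₁ b₂ b₃` a P₄ instead, prefixing `y a′ a` would give a P₇;
      -- this is why a frame also records `b₂` and `b₃`, which `y` must miss.
      B-side-short : ∀ {x y us vs} → Frame x us → Frame y vs → Separated x us y vs →
                     Vec.lookup us (suc (suc zero)) ~ r
      B-side-short (frame _ _ _ _ _ _ _ _ (inj₁ b~r)) _ _ = b~r
      B-side-short
        {x} {y}
        (frame {a} {b₁} {b₂} {b₃} x≁p _ ¬P₄A Aa x~a a~p _ _
          (inj₂ (p₄ B₁ B₂ B₃ (xb₁ , (xb₂ ∷ xb₃ ∷ []) , b₁b₂ , (b₁b₃ ∷ []) , b₂b₃ , _))))
        (frame {a′} _ _ _ Aa′ y~a′ a′~p _ _ _)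
        ((x≁y ∷ a≁y ∷ b₁≁y ∷ b₂≁y ∷ b₃≁y ∷ []) , (_ ∷ a′≁x ∷ _)) =
        ⊥-elim (free (inducedP₇ y a′ a x b₁ b₂ b₃
          ( y~a′ , (≁-sym a≁y ∷ ≁-sym x≁y ∷ ≁-sym b₁≁y ∷ ≁-sym b₂≁y ∷ ≁-sym b₃≁y ∷ [])
          , ~-sym (links-adjacent ¬P₄A x≁p Aa x~a a~p Aa′ a′~p (≁-sym a′≁x))
          , (a′≁x ∷ A≁B Aa′ B₁ ∷ A≁B Aa′ B₂ ∷ A≁B Aa′ B₃ ∷ [])
          , ~-sym x~a , (A≁B Aa B₁ ∷ A≁B Aa B₂ ∷ A≁B Aa B₃ ∷ [])
          , xb₁ , (xb₂ ∷ xb₃ ∷ []) , b₁b₂ , (b₁b₃ ∷ []) , b₂b₃ , [] , tt)))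

      no-three-frames : ∀ {x y z us vs ws} → Frame x us → Frame y vs → Frame z ws →
        Separated x us y vs → Separated x us z ws → Separated y vs z ws → ⊥
      no-three-frames {x} {y} {z}
        X@(frame {a₁} {b₁} x≁p x≁r ¬P₄x Aa₁ x~a₁ a₁~p Bb₁ x~b₁ _)
        Y@(frame {a₂} {b₂} y≁p y≁r ¬P₄y Aa₂ y~a₂ a₂~p Bb₂ y~b₂ _)
        Z@(frame {a₃} {b₃} z≁p z≁r ¬P₄z Aa₃ z~a₃ a₃~p Bb₃ z~b₃ _)
        xy@((x≁y ∷ a₁≁y ∷ b₁≁y ∷ _) , (_ ∷ a₂≁x ∷ b₂≁x ∷ _))
        xz@((x≁z ∷ a₁≁z ∷ b₁≁z ∷ _) , (_ ∷ a₃≁x ∷ b₃≁x ∷ _))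
        ((y≁z ∷ a₂≁z ∷ b₂≁z ∷ _) , (_ ∷ a₃≁y ∷ b₃≁y ∷ _))
        with adj G b₁ b₂ in b₁?b₂
      -- The edge `b₁ b₂` joins `x` to `y` through `B`; the edge `a₂ a₃` prolongs the path through
      -- `A` to `z`.
      ... | true = free (inducedP₇ z a₃ a₂ y b₂ b₁ x
          ( z~a₃ , (≁-sym a₂≁z ∷ ≁-sym y≁z ∷ ≁-sym b₂≁z ∷ ≁-sym b₁≁z ∷ ≁-sym x≁z ∷ [])
          , links-adjacent ¬P₄z z≁p Aa₃ z~a₃ a₃~p Aa₂ a₂~p (≁-sym a₂≁z)
          , (a₃≁y ∷ A≁B Aa₃ Bb₂ ∷ A≁B Aa₃ Bb₁ ∷ a₃≁x ∷ [])
          , ~-sym y~a₂ , (A≁B Aa₂ Bb₂ ∷ A≁B Aa₂ Bb₁ ∷ a₂≁x ∷ [])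
          , y~b₂ , (≁-sym b₁≁y ∷ ≁-sym x≁y ∷ [])
          , ~-sym b₁?b₂ , (b₂≁x ∷ []) , ~-sym x~b₁ , [] , tt))
      -- Both `b₁` and `b₂` are adjacent to `r`, so `x` and `y` are joined through `r`; the edge
      -- `a₁ a₃` supplies the remaining length.
      ... | false = free (inducedP₇ y b₂ r b₁ x a₁ a₃
          ( y~b₂ , (y≁r ∷ ≁-sym b₁≁y ∷ ≁-sym x≁y ∷ ≁-sym a₁≁y ∷ ≁-sym a₃≁y ∷ [])
          , B-side-short Y X (proj₂ xy , proj₁ xy)
          , (≁-sym b₁?b₂ ∷ b₂≁x ∷ ≁-sym (A≁B Aa₁ Bb₂) ∷ ≁-sym (A≁B Aa₃ Bb₂) ∷ [])
          , ~-sym (B-side-short X Y xy) , (≁-sym x≁r ∷ ≁-sym (A≁B Aa₁ Br) ∷ ≁-sym (A≁B Aa₃ Br) ∷ [])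
          , ~-sym x~b₁ , (≁-sym (A≁B Aa₁ Bb₁) ∷ ≁-sym (A≁B Aa₃ Bb₁) ∷ [])
          , x~a₁ , (≁-sym a₃≁x ∷ [])
          , links-adjacent ¬P₄x x≁p Aa₁ x~a₁ a₁~p Aa₃ a₃~p (≁-sym a₃≁x) , [] , tt))

-- The constant, and the contradiction from light neighbourhoods.

α : ℚ
-- The requirement is `24 · α < ½`: `2 · α` for the neighbourhoods of `p` and `r`, and `11 · α` for
-- each of the two removals in `independent-triple`.
α = ℤ.+ 1 / 64

module _ (G : Graph n) (free : P7Free G) (S : Subset n) (μ : Fin n → ℚ)
         (prob : IsProbabilityOn S μ) (light : ∀ v → μN G S μ v ≤ α) where

  open Paths G
  open Measure S μ (proj₁ prob)

  m-nbhd : ∀ {k} (us : Vec (Fin n) k) → m (nbhd us) ≤ k · α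
  m-nbhd []       = ≤-reflexive m-∅
  m-nbhd (u ∷ us) =
    ≤-trans (m-cover (nbhd (u ∷ us)) (adj G u) (nbhd us) (λ v _ → split v))
            (+-mono-≤ (light u) (m-nbhd us))
    where
    split : ∀ v → nbhd (u ∷ us) v ≡ true → adj G u v ≡ true ⊎ nbhd us v ≡ true
    split v h with adj G u v
    ... | true  = inj₁ refl
    ... | false = inj₂ h

  module _ {A B : Fin n → Set} (A≁B : Anticomplete A B) {p r : Fin n} (Ap : A p) (Br : B r)
           (linkA : ∀ x → x ∈ S → x ≁ p → Link A p x ⊎ StartsP₄ A x)
           (linkB : ∀ x → x ∈ S → x ≁ r → Link B r x ⊎ StartsP₄ B x) where

    open Frames free A B A≁B Ap Br

    -- If `Q` had measure at least `½`, the points of `Q` outside the neighbourhoods of `p` and `r`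
    -- would all carry frames, and averaging would find three mutually separated ones.
    light-side : (Q : Fin n → Bool) →
                 (∀ x → Q x ≡ true → x ∈ S × ¬ StartsP₄ A x) → m Q < ½
    light-side Q Q-spec = ≰⇒> λ ½≤mQ →
      case-triple (independent-triple R 5α<6α (λ u → m-nbhd (proj₁ (choose u))) T
        (toWitness {a? = 0ℚ ≤? 5 · α + 6 · α} tt) (T-large ½≤mQ))
      where
      T : Fin n → Bool
      T = Q ∖ nbhd (p ∷ r ∷ [])

      T-frame : ∀ x → T x ≡ true → ∃ (Frame x)
      T-frame x Tx with ∧-true {Q x} Tx
      ... | Qx , far with Q-spec x Qx | ∉nbhd (p ∷ r ∷ []) (not-true far)
      ... | x∈S , ¬P₄A | p≁x ∷ r≁x ∷ [] with linkA x x∈S (≁-sym p≁x)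
      ... | inj₁ link = make-frame (≁-sym p≁x) (≁-sym r≁x) ¬P₄A link (linkB x x∈S (≁-sym r≁x))
      ... | inj₂ path = contradiction path ¬P₄A

      choose : ∀ x → Σ (Vec (Fin n) 5) λ us → T x ≡ true → Frame x us
      choose x with T x Bool.≟ true
      ... | yes Tx = proj₁ (T-frame x Tx) , λ _ → proj₂ (T-frame x Tx)
      -- A filler that makes `R` total; any five vertices satisfy the out-measure bound.
      ... | no ¬Tx = Vec.replicate 5 x , λ Tx → contradiction Tx ¬Tx

      R : Fin n → Fin n → Bool
      R x = nbhd (proj₁ (choose x))

      -- Five is the length of a frame, so `m-nbhd` bounds every out-measure of `R` by `5 · α`;
      -- `6 · α` provides the strict gap for averaging.
      5α<6α : 5 · α < 6 · α
      5α<6α = toWitness {a? = 5 · α <? 6 · α} tt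

      T-large : ½ ≤ m Q → (5 · α + 6 · α) + (5 · α + 6 · α) < m T
      T-large ½≤mQ = ≤+⇒< (<-≤-trans (toWitness {a? = _ <? ½} tt) ½≤mQ)
        (≤-trans (m-∖ Q (nbhd (p ∷ r ∷ []))) (+-monoʳ-≤ (m T) (m-nbhd (p ∷ r ∷ []))))

      separated : ∀ {x y} → R x y ≡ false × R y x ≡ false →
                  Separated x (proj₁ (choose x)) y (proj₁ (choose y))
      separated (xy , yx) = ∉nbhd _ xy , ∉nbhd _ yx

      case-triple : ¬ (∃ λ x → ∃ λ y → ∃ λ z → T x ≡ true × T y ≡ true × T z ≡ true ×
        (R x y ≡ false × R y x ≡ false) × (R x z ≡ false × R z x ≡ false) ×
        (R y z ≡ false × R z y ≡ false))
      case-triple (x , y , z , Tx , Ty , Tz , xy , xz , yz) =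
        no-three-frames (proj₂ (choose x) Tx) (proj₂ (choose y) Ty) (proj₂ (choose z) Tz)
          (separated xy) (separated xz) (separated yz)

  not-all-light : ¬ MinimalSeparator G S
  not-all-light (s , t , min@((_ , s∉S , t∉S , sep) , _)) =
    ¬¬-∀ (λ x → attached? min) λ attA →
    ¬¬-∀ (λ x → attached? (MinimalSeparatorFor-sym min)) λ attB →
    ¬¬-∀ (λ x → ¬¬-excluded-middle {A = StartsP₄ A x}) (main attA attB)
    where
    A B : Fin n → Set
    A = component S s
    B = component S t
    A≁B : Anticomplete A B
    A≁B = component-anticomplete S sep
    B≁A : Anticomplete B A
    B≁A Bb Aa = ≁-sym (A≁B Aa Bb)

    Attached : Fin n → Fin n → Set
    Attached q x = x ∈ S → ∃ λ a → component S q a × x ~ a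

    -- `¬¬-∀` ranges over all vertices, so membership in `S` has to move inside the double negation.
    attached? : ∀ {q q′ x} → MinimalSeparatorFor G S q q′ → ¬ ¬ Attached q x
    attached? {x = x} mn k = k λ x∈S → ⊥-elim (attached S mn x x∈S (λ a → k (λ _ → a)))

    -- `Q` and `Q′` split `S` by whether a P₄ into `A` starts at `x`. On `Q′` none starts into `B`,
    -- so `light-side` applies there with the sides exchanged, and two measures below `½` cannot add
    -- up to one.
    main : (∀ x → Attached s x) → (∀ x → Attached t x) → ¬ (∀ x → Dec (StartsP₄ A x))
    main attA attB P₄A? = <-irrefl refl (begin-strict
      1ℚ           ≡⟨ proj₂ prob ⟨
      m (λ _ → true) ≤⟨ m-cover (λ _ → true) Q Q′ cover ⟩
      m Q + m Q′   <⟨ +-mono-< (light-side A≁B (here s∉S) (here t∉S) linkA linkB Q Q-spec)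
                               (light-side B≁A (here t∉S) (here s∉S) linkB linkA Q′ Q′-spec) ⟩
      ½ + ½        ≡⟨⟩
      1ℚ           ∎)
      where
      open ≤-Reasoning
      linkA : ∀ x → x ∈ S → x ≁ s → Link A s x ⊎ StartsP₄ A x
      linkA x x∈S x≁s = link-or-P₄ S x x≁s (attA x x∈S)
      linkB : ∀ x → x ∈ S → x ≁ t → Link B t x ⊎ StartsP₄ B x
      linkB x x∈S x≁t = link-or-P₄ S x x≁t (attB x x∈S)
      Q Q′ : Fin n → Bool
      Q  x = Vec.lookup S x ∧ not (does (P₄A? x))
      Q′ x = Vec.lookup S x ∧ does (P₄A? x)
      Q-spec : ∀ x → Q x ≡ true → x ∈ S × ¬ StartsP₄ A x
      Q-spec x Qx with ∧-true {Vec.lookup S x} Qx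
      ... | x∈S , ¬P₄ with P₄A? x
      ...   | no h = lookup⇒[]= x S x∈S , h
      Q′-spec : ∀ x → Q′ x ≡ true → x ∈ S × ¬ StartsP₄ B x
      Q′-spec x Q′x with ∧-true {Vec.lookup S x} Q′x
      ... | x∈S , P₄ with P₄A? x
      ...   | yes h = lookup⇒[]= x S x∈S , P₄-one-side free A B A≁B h
      cover : ∀ x → Vec.lookup S x ≡ true → true ≡ true → Q x ≡ true ⊎ Q′ x ≡ true
      cover x x∈S _ rewrite x∈S with P₄A? x
      ... | yes _ = inj₂ refl
      ... | no  _ = inj₁ refl

theorem3 : Σ ℚ λ α → 0ℚ < α ×
    (∀ (n : ℕ) (G : Graph n) → P7Free G →
    ∀ (S : Subset n) → MinimalSeparator G S →
    ∀ (μ : Fin n → ℚ) → IsProbabilityOn S μ →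
    Σ (Fin n) λ v → α ≤ μN G S μ v)
theorem3 = α , toWitness {a? = 0ℚ <? α} tt , find
  where
  find : ∀ n (G : Graph n) → P7Free G → ∀ S → MinimalSeparator G S →
         ∀ μ → IsProbabilityOn S μ → Σ (Fin n) λ v → α ≤ μN G S μ v
  find n G free S min μ prob with any? (λ v → α ≤? μN G S μ v)
  ... | yes found = found
  ... | no  none  = ⊥-elim (not-all-light G free S μ prob
          (λ v → <⇒≤ (≰⇒> (λ α≤ → none (v , α≤)))) min)
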